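{- Let $n\ge 2$ and let $G$ be a tree on $n$ vertices. Then $\mathrm{irr}_t(G)\ge 2n-4$, with equality if and only if $G\cong P_n$.
   Context: For a graph $G=(V,E)$ and $w\in V$, $d_G(w)$ is the degree of $w$. The total irregularity is $\mathrm{irr}_t(G)=\frac12\sum_{x,y\in V}|d_G(x)-d_G(y)|$, where the sum runs over all ordered pairs of vertices. $P_n$ denotes the path on $n$ vertices. -}

module Defs where

open import Data.Fin.Base using (Fin; zero; suc; toℕ; fromℕ; inject₁)
open import Data.Integer.Base using (+_)
open import Data.Nat.Base using (ℕ; suc; _≤_; ∣_-_∣)
open import Data.Nat.Properties using (_≟_; 1+n≢n; +-0-commutativeMonoid)
open import Data.Product.Base using (_×_)
open import Data.Rational.Base using (ℚ; _/_)
open import Data.Sum.Base using (_⊎_; inj₁; inj₂; swap)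
open import Data.Vec.Base using (count; allFin)
open import Function.Bundles using (_↔_; _⇔_; Inverse)
open import Function.Definitions using (Injective)
open import Level using (0ℓ)
open import Relation.Binary.Core using (Rel)
open import Relation.Binary.Construct.Closure.ReflexiveTransitive using (Star)
open import Relation.Binary.Definitions using (Decidable; Symmetric; Irreflexive)
open import Relation.Binary.PropositionalEquality.Core using (_≡_; refl)
open import Relation.Nullary.Decidable.Core using (_⊎-dec_)
open import Relation.Nullary.Negation.Core using (¬_)

open import Algebra.Properties.CommutativeMonoid.Sum +-0-commutativeMonoid using (sum-syntax)

record Graph (n : ℕ) : Set₁ where
  field
    Adj    : Rel (Fin n) 0ℓ
    adj?   : Decidable Adj
    sym    : Symmetric Adj
    irrefl : Irreflexive _≡_ Adj

open Graph public using (Adj; adj?)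

degree : ∀ {n} → Graph n → Fin n → ℕ
degree {n} G x = count (adj? G x) (allFin n)

Connected : ∀ {n} → Graph n → Set
Connected G = ∀ x y → Star (Adj G) x y

-- A cycle through the suc m ≥ 3 distinct vertices
-- vertex 0, …, vertex m.
record Cycle {n} (G : Graph n) : Set where
  field
    m         : ℕ
    2≤m       : 2 ≤ m
    vertex    : Fin (suc m) → Fin n
    injective : Injective _≡_ _≡_ vertex
    step      : (i : Fin m) → Adj G (vertex (inject₁ i)) (vertex (suc i))
    close     : Adj G (vertex (fromℕ m)) (vertex zero)

Acyclic : ∀ {n} → Graph n → Set
Acyclic G = ¬ Cycle G

IsTree : ∀ {n} → Graph n → Set
IsTree G = Connected G × Acyclic G

infix 4 _≅_

record _≅_ {m n} (G : Graph m) (H : Graph n) : Set where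
  field
    bijection : Fin m ↔ Fin n

  open Inverse bijection public using (to; from)

  field
    adj⇔ : ∀ x y → Adj G x y ⇔ Adj H (to x) (to y)

P : (n : ℕ) → Graph n
P n = record
  { Adj    = λ i j → suc (toℕ i) ≡ toℕ j ⊎ suc (toℕ j) ≡ toℕ i
  ; adj?   = λ i j → (suc (toℕ i) ≟ toℕ j) ⊎-dec (suc (toℕ j) ≟ toℕ i)
  ; sym    = swap
  ; irrefl = λ where
      refl (inj₁ eq) → 1+n≢n eq
      refl (inj₂ eq) → 1+n≢n eq
  }

-- The sum runs over ordered pairs, and the halving takes place in ℚ, so
-- nothing is rounded.
irrₜ : ∀ {n} → Graph n → ℚ
irrₜ {n} G = (+ (∑[ x < n ] ∑[ y < n ] ∣ degree G x - degree G y ∣)) / 2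

{-# OPTIONS --safe #-}
module Submission where

-- Let d be the degree, L the number of leaves and D = ∑ₓ (d(x) − 1). A leaf x contributes
-- ∣d(x) − d(y)∣ = d(y) − 1 to the pair (x , y), so 2 irrₜ(G) ≥ 2 L D. Both ends of a maximal
-- path in a tree are leaves, hence L ≥ 2, and connectedness gives D ≥ n − 2; so irrₜ(G) ≥ 2n − 4.
-- In the case of equality L ≤ 2 (if n > 2) and D = n − 2, and L + D = n + ∑ₓ max(d(x) − 2, 0)
-- shows that no degree exceeds 2; a maximal path ending at a leaf then contains every vertex.

open import Defs
open import Data.Nat.Base using (ℕ; _*_) renaming (_≤_ to _≤ℕ_)
open import Data.Integer.Base using (+_; _-_)
open import Data.Product.Base using (_×_)
open import Data.Rational.Base using (_/_; _≥_)
open import Function.Bundles using (_⇔_)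
open import Relation.Binary.PropositionalEquality.Core using (_≡_)

open import Data.Nat.Properties hiding (suc-injective)

open import Algebra.Properties.CommutativeMonoid.Sum +-0-commutativeMonoid
  using (sum; sum-syntax; sum-cong-≗; ∑-distrib-+; ∑-comm; sum-permute; sum-replicate-zero)
open import Algebra.Properties.Semiring.Sum +-*-semiring
  using (*-distribˡ-sum; *-distribʳ-sum)
open import Data.Bool.Base using (true; false; if_then_else_)
open import Data.Fin.Base using (Fin; zero; suc; toℕ; fromℕ; fromℕ<; inject₁)
open import Data.Fin.Properties
  using (any?; suc-injective; injective⇒≤; toℕ-injective; toℕ-inject₁; toℕ-fromℕ; toℕ-fromℕ<; toℕ<n)
  renaming (_≟_ to _≟ᶠ_)
import Data.Integer.Base as ℤ
import Data.Integer.Properties as ℤ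
open import Data.List.Base as List using (List; []; _∷_; [_]; _++_; length; allFin)
open import Data.List.Membership.Propositional using (_∈_; _∉_)
open import Data.List.Membership.Propositional.Properties using (∈-∃++; ∈-allFin)
open import Data.List.Properties using (map-tabulate; length-tabulate)
open import Data.List.Relation.Binary.Permutation.Propositional.Properties
  using (shift; ∈-resp-↭; map⁺)
open import Data.List.Relation.Unary.All as All using (All; []; _∷_)
open import Data.List.Relation.Unary.All.Properties using (¬Any⇒All¬)
open import Data.List.Relation.Unary.AllPairs using ([]; _∷_)
open import Data.List.Relation.Unary.Any using (here; there)
open import Data.List.Relation.Unary.Unique.Propositional using (Unique)
open import Data.List.Relation.Unary.Unique.Propositional.Properties using (allFin⁺)
open import Data.Nat.Base
  using (zero; suc; _+_; _∸_; _≤_; _<_; z≤n; s≤s; s≤s⁻¹; ∣_-_∣; >-nonZero)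
open import Data.Nat.ListAction using () renaming (sum to sumᴸ)
open import Data.Nat.ListAction.Properties using (sum-↭)
open import Data.Nat.Tactic.RingSolver using (solve-∀)
open import Data.Product.Base using (∃; ∃₂; _,_; proj₁; proj₂)
import Data.Rational.Properties as ℚ
import Data.Rational.Unnormalised.Base as ℚᵘ
import Data.Rational.Unnormalised.Properties as ℚᵘ
open import Data.Sum.Base using (_⊎_; inj₁; inj₂)
import Data.Vec.Base as Vec
open import Function.Base using (_∘_; id; _$_)
open import Function.Bundles using (mk⇔; mk↔ₛ′; Equivalence)
open import Level using (0ℓ)
open import Relation.Binary.Construct.Closure.ReflexiveTransitive using (Star; ε; _◅_)
open import Relation.Binary.PropositionalEquality
  using (_≢_; refl; sym; trans; cong; cong₂; subst; subst₂; module ≡-Reasoning)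
open import Relation.Nullary using (Dec; yes; no; ¬_; contradiction; does)
open import Relation.Nullary.Decidable using (_×-dec_; ¬?; decidable-stable; dec-true; dec-false)
open import Relation.Unary using (Pred; Decidable)

import Data.List.Membership.DecPropositional as DecMembership

private
  variable
    n : ℕ

-- Finite sums

∑-mono-≤ : {f g : Fin n → ℕ} → (∀ i → f i ≤ g i) → sum f ≤ sum g
∑-mono-≤ {zero}  f≤g = z≤n
∑-mono-≤ {suc n} f≤g = +-mono-≤ (f≤g zero) (∑-mono-≤ (f≤g ∘ suc))

≤∑ : (f : Fin n → ℕ) → ∀ i → f i ≤ sum f
≤∑ f zero    = m≤m+n _ _
≤∑ f (suc i) = ≤-trans (≤∑ (f ∘ suc) i) (m≤n+m _ _)

∑-zero : {f : Fin n → ℕ} → (∀ i → f i ≡ 0) → sum f ≡ 0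
∑-zero {n} f≡0 = trans (sum-cong-≗ f≡0) (sum-replicate-zero n)

∑-one : ∀ n → ∑[ i < n ] 1 ≡ n
∑-one zero    = refl
∑-one (suc n) = cong suc (∑-one n)

∑∑-* : (f g : Fin n → ℕ) → ∑[ x < n ] ∑[ y < n ] (f x * g y) ≡ sum f * sum g
∑∑-* f g = trans (sum-cong-≗ λ x → sym (*-distribˡ-sum (f x) g))
                 (sym (*-distribʳ-sum (sum g) f))

sumᴸ-allFin : (f : Fin n → ℕ) → sumᴸ (List.map f (allFin n)) ≡ sum f
sumᴸ-allFin f = trans (cong sumᴸ (map-tabulate id f)) (sumᴸ-tabulate f)
  where
  sumᴸ-tabulate : ∀ {n} (f : Fin n → ℕ) → sumᴸ (List.tabulate f) ≡ sum f
  sumᴸ-tabulate {zero}  f = refl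
  sumᴸ-tabulate {suc n} f = cong₂ _+_ refl (sumᴸ-tabulate (f ∘ suc))

module _ {A : Set} where

  sumᴸ-map-+ : (f g : A → ℕ) → ∀ xs →
    sumᴸ (List.map (λ x → f x + g x) xs) ≡ sumᴸ (List.map f xs) + sumᴸ (List.map g xs)
  sumᴸ-map-+ f g []       = refl
  sumᴸ-map-+ f g (x ∷ xs) rewrite sumᴸ-map-+ f g xs =
    lemma (f x) (g x) (sumᴸ (List.map f xs)) (sumᴸ (List.map g xs))
    where
    lemma : ∀ a b c d → a + b + (c + d) ≡ a + c + (b + d)
    lemma = solve-∀

  sumᴸ-mono-≤ : {f g : A → ℕ} → (∀ x → f x ≤ g x) → ∀ xs →
    sumᴸ (List.map f xs) ≤ sumᴸ (List.map g xs)
  sumᴸ-mono-≤ f≤g []       = z≤n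
  sumᴸ-mono-≤ f≤g (x ∷ xs) = +-mono-≤ (f≤g x) (sumᴸ-mono-≤ f≤g xs)

  -- Induction on `us`: a permutation brings `u` to the front of `vs`, and since `u` does not recur
  -- in `us`, the rest of `us` lies in what remains of `vs`.
  sumᴸ-⊆ : (f : A → ℕ) → ∀ {us vs} → Unique us → (∀ {x} → x ∈ us → x ∈ vs) →
    sumᴸ (List.map f us) ≤ sumᴸ (List.map f vs)
  sumᴸ-⊆ f {[]}     _             _   = z≤n
  sumᴸ-⊆ f {u ∷ us} {vs} (u∉us ∷ unique) us⊆vs
    with ps , qs , refl ← ∈-∃++ (us⊆vs (here refl)) = begin
    f u + sumᴸ (List.map f us)         ≤⟨ +-monoʳ-≤ (f u) (sumᴸ-⊆ f unique us⊆) ⟩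
    f u + sumᴸ (List.map f (ps ++ qs)) ≡⟨ sum-↭ (map⁺ f (shift u ps qs)) ⟨
    sumᴸ (List.map f vs)               ∎
    where
    open ≤-Reasoning
    us⊆ : ∀ {x} → x ∈ us → x ∈ ps ++ qs
    us⊆ x∈us with ∈-resp-↭ (shift u ps qs) (us⊆vs (there x∈us))
    ... | here refl = contradiction refl (All.lookup u∉us x∈us)
    ... | there x∈  = x∈

sumᴸ-unique : (f : Fin n → ℕ) → ∀ {us} → Unique us → sumᴸ (List.map f us) ≤ sum f
sumᴸ-unique f unique =
  ≤-trans (sumᴸ-⊆ f unique λ _ → ∈-allFin _) (≤-reflexive (sumᴸ-allFin f))

-- Indicators and counting

𝟙 : {A : Set} → Dec A → ℕ
𝟙 d = if does d then 1 else 0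

𝟙-true : {A : Set} (d : Dec A) → A → 𝟙 d ≡ 1
𝟙-true d a = cong (if_then 1 else 0) (dec-true d a)

𝟙-false : {A : Set} (d : Dec A) → ¬ A → 𝟙 d ≡ 0
𝟙-false d ¬a = cong (if_then 1 else 0) (dec-false d ¬a)

-- The two decisions are unrelated, as are the `adj?` of two isomorphic graphs.
𝟙-⇔ : {A B : Set} (d : Dec A) (e : Dec B) → A ⇔ B → 𝟙 d ≡ 𝟙 e
𝟙-⇔ d (yes b) A⇔B = 𝟙-true d (Equivalence.from A⇔B b)
𝟙-⇔ d (no ¬b) A⇔B = 𝟙-false d (¬b ∘ Equivalence.to A⇔B)

count-tabulate : ∀ {k} {A : Set} {Q : Pred A 0ℓ} (Q? : Decidable Q) (f : Fin k → A) →
  Vec.count Q? (Vec.tabulate f) ≡ ∑[ i < k ] 𝟙 (Q? (f i))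
count-tabulate {zero}  Q? f = refl
count-tabulate {suc k} Q? f with does (Q? (f zero))
... | true  = cong suc (count-tabulate Q? (f ∘ suc))
... | false = count-tabulate Q? (f ∘ suc)

module _ {Q : Pred (Fin n) 0ℓ} (Q? : Decidable Q) where

  -- A list of distinct witnesses bounds a count from below; this gives the lower bounds on degrees
  -- and on the number of leaves.
  length≤∑𝟙 : ∀ {us} → Unique us → All Q us → length us ≤ ∑[ i < n ] 𝟙 (Q? i)
  length≤∑𝟙 unique all = ≤-trans (≤-reflexive (length≡ all)) (sumᴸ-unique (𝟙 ∘ Q?) unique)
    where
    length≡ : ∀ {us} → All Q us → length us ≡ sumᴸ (List.map (𝟙 ∘ Q?) us)
    length≡ []        = refl
    length≡ (q ∷ all) = cong₂ _+_ (sym (𝟙-true (Q? _) q)) (length≡ all)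

∑𝟙≤1 : {Q : Pred (Fin n) 0ℓ} (Q? : Decidable Q) → (∀ {i j} → Q i → Q j → i ≡ j) →
  ∑[ i < n ] 𝟙 (Q? i) ≤ 1
∑𝟙≤1 {zero}  Q? _      = z≤n
∑𝟙≤1 {suc n} Q? unique with Q? zero
... | yes q = s≤s (≤-reflexive (∑-zero λ i →
                𝟙-false (Q? (suc i)) λ q′ → contradiction (unique q q′) λ ()))
... | no _  = ∑𝟙≤1 (Q? ∘ suc) λ q q′ → suc-injective (unique q q′)

length-⊆ : {us vs : List (Fin n)} → Unique us → (∀ {x} → x ∈ us → x ∈ vs) →
  length us ≤ length vs
length-⊆ {us = us} {vs} unique us⊆vs =
  subst₂ _≤_ (∑1 us) (∑1 vs) (sumᴸ-⊆ (λ _ → 1) unique us⊆vs)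
  where
  ∑1 : ∀ {A : Set} (xs : List A) → sumᴸ (List.map (λ _ → 1) xs) ≡ length xs
  ∑1 []       = refl
  ∑1 (x ∷ xs) = cong suc (∑1 xs)

length-unique : {us : List (Fin n)} → Unique us → length us ≤ n
length-unique unique =
  ≤-trans (length-⊆ unique λ _ → ∈-allFin _) (≤-reflexive (length-tabulate id))

length-complete : {vs : List (Fin n)} → (∀ x → x ∈ vs) → n ≤ length vs
length-complete {n} complete =
  ≤-trans (≤-reflexive (sym (length-tabulate id))) (length-⊆ (allFin⁺ n) λ _ → complete _)

-- Degrees and neighbours

module _ {n : ℕ} (G : Graph n) where

  degree≡∑ : ∀ x → degree G x ≡ ∑[ y < n ] 𝟙 (adj? G x y)
  degree≡∑ x = count-tabulate (adj? G x) id

  length≤degree : ∀ {x us} → Unique us → All (Adj G x) us → length us ≤ degree G x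
  length≤degree {x} unique all =
    subst (_ ≤_) (sym (degree≡∑ x)) (length≤∑𝟙 (adj? G x) unique all)

  1≤degree : ∀ {x y} → Adj G x y → 1 ≤ degree G x
  1≤degree x~y = length≤degree ([] ∷ []) (x~y ∷ [])

  neighbour-unique : ∀ {x y z} → degree G x ≤ 1 → Adj G x y → Adj G x z → y ≡ z
  neighbour-unique {y = y} {z} d≤1 x~y x~z = decidable-stable (y ≟ᶠ z) λ y≢z →
    <⇒≱ (length≤degree ((y≢z ∷ []) ∷ [] ∷ []) (x~y ∷ x~z ∷ [])) d≤1

  -- Otherwise `w`, `y` and `z` would be three distinct neighbours of `x`.
  third-neighbour : ∀ {x y z w} → degree G x ≤ 2 → y ≢ z →
    Adj G x y → Adj G x z → Adj G x w → w ≡ y ⊎ w ≡ z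
  third-neighbour {y = y} {z} {w} d≤2 y≢z x~y x~z x~w with w ≟ᶠ y | w ≟ᶠ z
  ... | yes w≡y | _       = inj₁ w≡y
  ... | no _    | yes w≡z = inj₂ w≡z
  ... | no w≢y  | no w≢z  = contradiction d≤2 $ <⇒≱ $
    length≤degree ((w≢y ∷ w≢z ∷ []) ∷ (y≢z ∷ []) ∷ [] ∷ []) (x~w ∷ x~y ∷ x~z ∷ [])

  connected⇒neighbour : Connected G → ∀ {x y} → x ≢ y → ∃ λ z → Adj G x z
  connected⇒neighbour connected {x} {y} x≢y with connected x y
  ... | ε       = contradiction refl x≢y
  ... | x~z ◅ _ = _ , x~z

  -- The degree sum of a connected graph

  open DecMembership (_≟ᶠ_ {n}) using (_∈?_)

  degreeWithin : List (Fin n) → Fin n → ℕ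
  degreeWithin vs x = sumᴸ (List.map (λ y → 𝟙 (adj? G x y)) vs)

  -- For `vs` without repetitions this is twice the number of edges of the subgraph induced on `vs`.
  degreeSumWithin : List (Fin n) → ℕ
  degreeSumWithin vs = sumᴸ (List.map (degreeWithin vs) vs)

  1≤degreeWithin : ∀ {x y vs} → y ∈ vs → Adj G x y → 1 ≤ degreeWithin vs x
  1≤degreeWithin {x} {y} y∈vs x~y = ≤-trans (≤-reflexive (sym 1≡))
    (sumᴸ-⊆ (λ y → 𝟙 (adj? G x y)) ([] ∷ []) λ where (here refl) → y∈vs)
    where
    1≡ : 𝟙 (adj? G x y) + 0 ≡ 1
    1≡ = cong (_+ 0) (𝟙-true (adj? G x y) x~y)

  -- The edge between `u` and `v` is counted twice, once in the row of `v` and once in the column of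
  -- `v`.
  degreeSumWithin-∷ : ∀ {u v vs} → u ∈ vs → Adj G u v →
    2 + degreeSumWithin vs ≤ degreeSumWithin (v ∷ vs)
  degreeSumWithin-∷ {u} {v} {vs} u∈vs u~v = begin
    1 + (1 + degreeSumWithin vs)
      ≤⟨ +-mono-≤ (≤-trans (1≤degreeWithin u∈vs (Graph.sym G u~v)) (m≤n+m _ (𝟙 (adj? G v v))))
                  (+-monoˡ-≤ _ 1≤into-v) ⟩
    degreeWithin (v ∷ vs) v + (sumᴸ (List.map (λ x → 𝟙 (adj? G x v)) vs) + degreeSumWithin vs)
      ≡⟨ cong₂ _+_ {x = degreeWithin (v ∷ vs) v} refl
           (sumᴸ-map-+ (λ x → 𝟙 (adj? G x v)) (degreeWithin vs) vs) ⟨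
    degreeSumWithin (v ∷ vs) ∎
    where
    open ≤-Reasoning
    1≤into-v : 1 ≤ sumᴸ (List.map (λ x → 𝟙 (adj? G x v)) vs)
    1≤into-v = ≤-trans (≤-reflexive (sym (cong (_+ 0) (𝟙-true (adj? G u v) u~v))))
      (sumᴸ-⊆ (λ x → 𝟙 (adj? G x v)) ([] ∷ []) λ where (here refl) → u∈vs)

  -- Take the first edge on which the walk leaves `vs`.
  exit : ∀ {x y vs} → Star (Adj G) x y → x ∈ vs → y ∉ vs →
    ∃₂ λ u v → u ∈ vs × v ∉ vs × Adj G u v
  exit ε x∈vs y∉vs = contradiction x∈vs y∉vs
  exit {x} {vs = vs} (_◅_ {j = z} x~z walk) x∈vs y∉vs with z ∈? vs
  ... | yes z∈vs = exit walk z∈vs y∉vs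
  ... | no z∉vs  = x , z , x∈vs , z∉vs , x~z

  -- Grows `vs` by one vertex at a time along an edge that leaves it. Each step adds 2 to the left
  -- side of the invariant and at least 2 to the right side.
  exhaust : Connected G → ∀ fuel r vs → n ≤ fuel + length vs → r ∈ vs → Unique vs →
    2 * length vs ≤ 2 + degreeSumWithin vs →
    ∃ λ us → (∀ x → x ∈ us) × Unique us × 2 * length us ≤ 2 + degreeSumWithin us
  exhaust connected fuel r vs n≤ r∈vs unique bound with any? (λ x → ¬? (x ∈? vs))
  ... | no none = vs , (λ x → decidable-stable (x ∈? vs) λ x∉vs → none (x , x∉vs)) , unique , bound
  ... | yes (y , y∉vs) with u , v , u∈vs , v∉vs , u~v ← exit (connected r y) r∈vs y∉vs
    with unique′ ← ¬Any⇒All¬ vs v∉vs ∷ unique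
    with fuel
  -- Without fuel `vs` already has `n` entries, so `v ∷ vs` would be too long to be free of
  -- repetitions.
  ... | zero   = contradiction n≤ (<⇒≱ (length-unique unique′))
  ... | suc f  = exhaust connected f r (v ∷ vs) (≤-trans n≤ (≤-reflexive (sym (+-suc f _))))
    (there r∈vs) unique′ (begin
      2 * length (v ∷ vs)            ≡⟨ *-suc 2 (length vs) ⟩
      2 + 2 * length vs              ≤⟨ +-monoʳ-≤ 2 bound ⟩
      2 + (2 + degreeSumWithin vs)   ≤⟨ +-monoʳ-≤ 2 (degreeSumWithin-∷ u∈vs u~v) ⟩
      2 + degreeSumWithin (v ∷ vs)   ∎)
    where open ≤-Reasoning

  -- This is the bound of n - 1 on the number of edges, doubled because the degree sum counts every
  -- edge twice.
  connected⇒2n≤2+∑degree : Connected G → Fin n → 2 * n ≤ 2 + sum (degree G)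
  connected⇒2n≤2+∑degree connected r
    with vs , complete , unique , bound ←
      exhaust connected n r [ r ] (m≤m+n n 1) (here refl) ([] ∷ []) (m≤m+n 2 _) = begin
    2 * n                                  ≤⟨ *-monoʳ-≤ 2 (length-complete complete) ⟩
    2 * length vs                          ≤⟨ bound ⟩
    2 + degreeSumWithin vs                 ≤⟨ +-monoʳ-≤ 2 (sumᴸ-mono-≤ within≤ vs) ⟩
    2 + sumᴸ (List.map (degree G) vs)      ≤⟨ +-monoʳ-≤ 2 (sumᴸ-unique (degree G) unique) ⟩
    2 + sum (degree G)                     ∎
    where
    open ≤-Reasoning
    within≤ : ∀ x → degreeWithin vs x ≤ degree G x
    within≤ x = ≤-trans (sumᴸ-unique _ unique) (≤-reflexive (sym (degree≡∑ x)))

  -- Maximal paths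

  -- The end `a` is fixed and the path grows at index 0. Taking `p` on all of ℕ, with only the
  -- indices up to `m` meaningful, makes prepending a vertex a mere shift.
  record PathTo (a : Fin n) : Set where
    field
      m         : ℕ
      p         : ℕ → Fin n
      end       : p m ≡ a
      injective : ∀ {i j} → i ≤ m → j ≤ m → p i ≡ p j → i ≡ j
      step      : ∀ {i} → i < m → Adj G (p i) (p (suc i))

    OnPath : Fin n → Set
    OnPath w = ∃ λ i → i ≤ m × p i ≡ w

    onPath? : Decidable OnPath
    onPath? w with any? {n = suc m} (λ i → p (toℕ i) ≟ᶠ w)
    ... | yes (i , eq) = yes (toℕ i , s≤s⁻¹ (toℕ<n i) , eq)
    ... | no none      = no λ (i , i≤m , eq) →
      none (fromℕ< (s≤s i≤m) , trans (cong p (toℕ-fromℕ< (s≤s i≤m))) eq)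

    m<n : m < n
    m<n = injective⇒≤ {f = λ (i : Fin (suc m)) → p (toℕ i)} λ {i} {j} eq →
      toℕ-injective (injective (s≤s⁻¹ (toℕ<n i)) (s≤s⁻¹ (toℕ<n j)) eq)

    -- Maximality is asked at the head only; nothing is said about the neighbours of the end.
    Maximal : Set
    Maximal = ∀ {w} → Adj G (p 0) w → OnPath w

  open PathTo

  trivial : ∀ a → PathTo a
  trivial a = record
    { m = 0 ; p = λ _ → a ; end = refl
    ; injective = λ where z≤n z≤n _ → refl
    ; step = λ () }

  extend : ∀ {a} (π : PathTo a) {w} → Adj G (p π 0) w → ¬ OnPath π w → PathTo a
  extend π {w} p₀~w w∉π = record
    { m = suc (m π) ; p = p′ ; end = end π ; injective = inj′ ; step = step′ }
    where
    p′ : ℕ → Fin n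
    p′ zero    = w
    p′ (suc i) = p π i
    inj′ : ∀ {i j} → i ≤ suc (m π) → j ≤ suc (m π) → p′ i ≡ p′ j → i ≡ j
    inj′ {zero}  {zero}  _ _ _ = refl
    inj′ {zero}  {suc j} _ (s≤s j≤m) eq = contradiction (j , j≤m , sym eq) w∉π
    inj′ {suc i} {zero}  (s≤s i≤m) _ eq = contradiction (i , i≤m , eq) w∉π
    inj′ {suc i} {suc j} (s≤s i≤m) (s≤s j≤m) eq = cong suc (injective π i≤m j≤m eq)
    step′ : ∀ {i} → i < suc (m π) → Adj G (p′ i) (p′ (suc i))
    step′ {zero}  _         = Graph.sym G p₀~w
    step′ {suc i} (s≤s i<m) = step π i<m

  -- Prepends a neighbour of the head as long as one lies off the path; `m<n` bounds the number of
  -- rounds.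
  maximise : ∀ {a} fuel (π : PathTo a) → n ≤ fuel + m π → ∃ (Maximal {a})
  maximise fuel π n≤ with any? (λ w → adj? G (p π 0) w ×-dec ¬? (onPath? π w))
  ... | no none = π , λ {w} p₀~w →
    decidable-stable (onPath? π w) λ w∉π → none (w , p₀~w , w∉π)
  ... | yes (w , p₀~w , w∉π) with fuel
  ...   | zero  = contradiction n≤ (<⇒≱ (m<n π))
  ...   | suc f = maximise f (extend π p₀~w w∉π) (≤-trans n≤ (≤-reflexive (sym (+-suc f _))))

  maximalPathTo : ∀ a → ∃ (Maximal {a})
  maximalPathTo a = maximise n (trivial a) (m≤m+n n 0)

  -- The initial segment up to index `i` has at least three vertices, and the chord closes it.
  chord⇒cycle : ∀ {a} (π : PathTo a) {i} → 2 ≤ i → i ≤ m π → Adj G (p π 0) (p π i) → Cycle G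
  chord⇒cycle π {i} 2≤i i≤m p₀~pᵢ = record
    { m         = i
    ; 2≤m       = 2≤i
    ; vertex    = p π ∘ toℕ
    ; injective = λ {j} {k} eq → toℕ-injective (injective π (bound j) (bound k) eq)
    ; step      = λ j → subst (λ k → Adj G (p π k) (p π (suc (toℕ j)))) (sym (toℕ-inject₁ j))
                          (step π (≤-trans (toℕ<n j) i≤m))
    ; close     = subst (λ k → Adj G (p π k) (p π 0)) (sym (toℕ-fromℕ i)) (Graph.sym G p₀~pᵢ)
    }
    where
    bound : ∀ (j : Fin (suc i)) → toℕ j ≤ m π
    bound j = ≤-trans (s≤s⁻¹ (toℕ<n j)) i≤m

  module _ (acyclic : Acyclic G) {a : Fin n} (π : PathTo a) (maximal : Maximal π) where

    -- By maximality `w` has an index on the path: 0 would be a loop, and 2 or more a chord closing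
    -- a cycle, so it is 1.
    head-neighbour : ∀ {w} → Adj G (p π 0) w → 1 ≤ m π × p π 1 ≡ w
    head-neighbour p₀~w with maximal p₀~w
    ... | zero        , _   , refl = contradiction p₀~w (Graph.irrefl G refl)
    ... | suc zero    , 1≤m , eq   = 1≤m , eq
    ... | suc (suc i) , i≤m , refl =
      contradiction (chord⇒cycle π (s≤s (s≤s z≤n)) i≤m p₀~w) acyclic

    head-degree : degree G (p π 0) ≤ 1
    head-degree = subst (_≤ 1) (sym (degree≡∑ (p π 0))) $ ∑𝟙≤1 (adj? G (p π 0)) λ x y →
      trans (sym (proj₂ (head-neighbour x))) (proj₂ (head-neighbour y))

    -- If they coincided, injectivity would force `m` to be 0, whereas `head-neighbour` applied to
    -- the neighbour of `a` gives `m` at least 1.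
    head≢end : ∀ {y} → Adj G a y → p π 0 ≢ a
    head≢end {y} a~y p₀≡a = contradiction (proj₁ (head-neighbour p₀~y)) (<⇒≱ m<1)
      where
      p₀~y : Adj G (p π 0) y
      p₀~y = subst (λ x → Adj G x y) (sym p₀≡a) a~y
      m<1 : m π < 1
      m<1 = s≤s (≤-reflexive (sym (injective π z≤n ≤-refl (trans p₀≡a (sym (end π))))))

  -- Every vertex of the path already has all the neighbours its degree allows on the path, so
  -- the path is closed under adjacency.
  module _ (connected : Connected G) (acyclic : Acyclic G) (degree≤2 : ∀ x → degree G x ≤ 2)
           {a : Fin n} (a-leaf : degree G a ≤ 1)
           (π : PathTo a) (maximal : Maximal π) where

    -- The relation between the indices is kept for `≅P`, where it becomes adjacency in `P n`.
    path-neighbour : ∀ {i} → i ≤ m π → ∀ {w} → Adj G (p π i) w →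
      ∃ λ j → j ≤ m π × p π j ≡ w × (suc i ≡ j ⊎ suc j ≡ i)
    path-neighbour {zero} _ p₀~w with head-neighbour acyclic π maximal p₀~w
    ... | 1≤m , eq = 1 , 1≤m , eq , inj₁ refl
    path-neighbour {suc i} i<m pᵢ~w with Graph.sym G (step π i<m) | m≤n⇒m<n∨m≡n i<m
    ... | pᵢ~prev | inj₂ 1+i≡m =
      i , <⇒≤ i<m , neighbour-unique end≤1 pᵢ~prev pᵢ~w , inj₂ refl
      where
      end≤1 : degree G (p π (suc i)) ≤ 1
      end≤1 = subst (λ x → degree G x ≤ 1) (sym (trans (cong (p π) 1+i≡m) (end π))) a-leaf
    ... | pᵢ~prev | inj₁ 1+i<m
      with third-neighbour (degree≤2 _) prev≢next pᵢ~prev (step π 1+i<m) pᵢ~w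
      where
      prev≢next : p π i ≢ p π (suc (suc i))
      prev≢next eq = m≢1+n+m i {1} (injective π (<⇒≤ i<m) 1+i<m eq)
    ...   | inj₁ refl = i , <⇒≤ i<m , refl , inj₂ refl
    ...   | inj₂ refl = suc (suc i) , 1+i<m , refl , inj₁ refl

    onPath-closed : ∀ {x y} → Star (Adj G) x y → OnPath π x → OnPath π y
    onPath-closed ε x∈π = x∈π
    onPath-closed (x~z ◅ walk) (i , i≤m , refl)
      with j , j≤m , pⱼ≡z , _ ← path-neighbour i≤m x~z = onPath-closed walk (j , j≤m , pⱼ≡z)

    onPath : ∀ x → OnPath π x
    onPath x = onPath-closed (connected a x) (m π , ≤-refl , end π)

    position : Fin n → ℕ
    position x = proj₁ (onPath x)

    position≤m : ∀ x → position x ≤ m π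
    position≤m x = proj₁ (proj₂ (onPath x))

    p-position : ∀ x → p π (position x) ≡ x
    p-position x = proj₂ (proj₂ (onPath x))

    -- Whichever index `onPath` happens to return, injectivity of the path pins it down.
    position-p : ∀ {i} → i ≤ m π → position (p π i) ≡ i
    position-p i≤m = injective π (position≤m _) i≤m (p-position _)

    position<n : ∀ x → position x < n
    position<n x = ≤-<-trans (position≤m x) (m<n π)

    -- `position` is injective because `p` undoes it. Hence every element of `Fin n` is a valid
    -- index of the path, as the inverse map in `≅P` requires.
    n≤1+m : n ≤ suc (m π)
    n≤1+m = injective⇒≤ {f = λ x → fromℕ< (s≤s (position≤m x))} λ {x} {y} eq →
      trans (sym (p-position x)) (trans (cong (p π)
        (trans (sym (toℕ-fromℕ< _)) (trans (cong toℕ eq) (toℕ-fromℕ< _)))) (p-position y))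

    ≅P : G ≅ P n
    ≅P = record
      { bijection = mk↔ₛ′ to (p π ∘ toℕ) to∘from from∘to
      ; adj⇔      = λ x y → mk⇔ (adj⇒ x y) (adj⇐ x y)
      }
      where
      to : Fin n → Fin n
      to x = fromℕ< (position<n x)
      toℕ-to : ∀ x → toℕ (to x) ≡ position x
      toℕ-to x = toℕ-fromℕ< (position<n x)
      to∘from : ∀ i → to (p π (toℕ i)) ≡ i
      to∘from i = toℕ-injective (trans (toℕ-to _)
        (position-p (s≤s⁻¹ (≤-trans (toℕ<n i) n≤1+m))))
      from∘to : ∀ x → p π (toℕ (to x)) ≡ x
      from∘to x = trans (cong (p π) (toℕ-to x)) (p-position x)
      adj⇒ : ∀ x y → Adj G x y → Adj (P n) (to x) (to y)
      adj⇒ x y x~y rewrite toℕ-to x | toℕ-to y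
        -- Here `y` becomes `p π j`, so its position is the index `j` next to that of `x`.
        with j , j≤m , refl , i~j ← path-neighbour (position≤m x)
               (subst (λ z → Adj G z y) (sym (p-position x)) x~y)
        rewrite position-p j≤m = i~j
      consecutive : ∀ x y → suc (position x) ≡ position y → Adj G x y
      consecutive x y eq = subst₂ (Adj G) (p-position x)
        (trans (cong (p π) eq) (p-position y))
        (step π (≤-trans (≤-reflexive eq) (position≤m y)))
      adj⇐ : ∀ x y → Adj (P n) (to x) (to y) → Adj G x y
      adj⇐ x y ij rewrite toℕ-to x | toℕ-to y with ij
      ... | inj₁ eq = consecutive x y eq
      ... | inj₂ eq = Graph.sym G (consecutive y x eq)

-- Twice the total irregularity.
imbalance : Graph n → ℕ
imbalance {n} G = ∑[ x < n ] ∑[ y < n ] ∣ degree G x - degree G y ∣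

-- Leaves, excess and the lower bound

isLeaf : ℕ → ℕ
isLeaf d = 𝟙 (d ≟ 1)

isLeaf+excess : ∀ {d} → 1 ≤ d → isLeaf d + (d ∸ 1) ≡ 1 + (d ∸ 2)
isLeaf+excess {suc zero}    _ = refl
isLeaf+excess {suc (suc d)} _ = refl

-- Equality holds as soon as one of the degrees is 1; if neither is, the left side vanishes.
isLeaf*excess≤∣-∣ : ∀ {d e} → 1 ≤ d → 1 ≤ e →
  isLeaf d * (e ∸ 1) + isLeaf e * (d ∸ 1) ≤ ∣ d - e ∣
isLeaf*excess≤∣-∣ {suc zero}    {suc zero}    _ _ = z≤n
isLeaf*excess≤∣-∣ {suc zero}    {suc (suc e)} _ _ = ≤-reflexive (trans (+-identityʳ _) (+-identityʳ _))
isLeaf*excess≤∣-∣ {suc (suc d)} {suc zero}    _ _ = ≤-reflexive (+-identityʳ _)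
isLeaf*excess≤∣-∣ {suc (suc d)} {suc (suc e)} _ _ = z≤n

-- With n written as `2 + k`, the bound 2n - 4 reads `2 * k` and the bound n - 2 on the excess reads
-- `k`.
module _ {k : ℕ} (G : Graph (2 + k)) (connected : Connected G) (acyclic : Acyclic G) where

  private
    N : ℕ
    N = 2 + k
    d : Fin N → ℕ
    d = degree G

  leaves excess : ℕ
  leaves = ∑[ x < N ] isLeaf (d x)
  excess = ∑[ x < N ] (d x ∸ 1)

  neighbour : ∀ x → ∃ (Adj G x)
  neighbour zero    = connected⇒neighbour G connected {y = suc zero} λ ()
  neighbour (suc x) = connected⇒neighbour G connected {y = zero} λ ()

  1≤d : ∀ x → 1 ≤ d x
  1≤d x = 1≤degree G (proj₂ (neighbour x))

  -- The head of a maximal path to `a` is a leaf. An arbitrary `a` yields a first leaf, and that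
  -- leaf in place of `a` yields a second.
  anotherLeaf : ∀ a → ∃ λ b → b ≢ a × d b ≡ 1
  anotherLeaf a with π , maximal ← maximalPathTo G a =
    _ , head≢end G acyclic π maximal (proj₂ (neighbour a)) ,
    ≤-antisym (head-degree G acyclic π maximal) (1≤d _)

  2≤leaves : 2 ≤ leaves
  2≤leaves with a , _ , a-leaf ← anotherLeaf zero
    with b , b≢a , b-leaf ← anotherLeaf a =
    length≤∑𝟙 (λ x → d x ≟ 1) ((b≢a ∷ []) ∷ [] ∷ []) (b-leaf ∷ a-leaf ∷ [])

  k≤excess : k ≤ excess
  -- The cancelled `4 + k` is `2 + N`: the 2 of the edge bound, and one for each vertex because the
  -- degree sum is `N + excess`.
  k≤excess = +-cancelˡ-≤ (4 + k) k excess (begin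
    4 + k + k                     ≡⟨ lemma k ⟩
    2 * N                         ≤⟨ connected⇒2n≤2+∑degree G connected zero ⟩
    2 + sum d
      ≡⟨ cong₂ _+_ {x = 2} refl (sum-cong-≗ (λ x → sym (m+[n∸m]≡n (1≤d x)))) ⟩
    2 + ∑[ x < N ] (1 + (d x ∸ 1))
      ≡⟨ cong₂ _+_ {x = 2} refl (∑-distrib-+ {N} (λ _ → 1) (λ x → d x ∸ 1)) ⟩
    2 + (∑[ x < N ] 1 + excess)   ≡⟨ cong (λ s → 2 + (s + excess)) (∑-one N) ⟩
    4 + k + excess                ∎)
    where
    open ≤-Reasoning
    lemma : ∀ k → 4 + k + k ≡ 2 * (2 + k)
    lemma = solve-∀

  -- The last sum measures how far the degrees exceed 2, so an upper bound on the left side controls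
  -- every degree.
  leaves+excess : leaves + excess ≡ N + ∑[ x < N ] (d x ∸ 2)
  leaves+excess = begin
    leaves + excess                        ≡⟨ ∑-distrib-+ (isLeaf ∘ d) (λ x → d x ∸ 1) ⟨
    ∑[ x < N ] (isLeaf (d x) + (d x ∸ 1))  ≡⟨ sum-cong-≗ (λ x → isLeaf+excess (1≤d x)) ⟩
    ∑[ x < N ] (1 + (d x ∸ 2))             ≡⟨ ∑-distrib-+ {N} (λ _ → 1) (λ x → d x ∸ 2) ⟩
    ∑[ x < N ] 1 + ∑[ x < N ] (d x ∸ 2)    ≡⟨ cong (_+ ∑[ x < N ] (d x ∸ 2)) (∑-one N) ⟩
    N + ∑[ x < N ] (d x ∸ 2)               ∎
    where open ≡-Reasoning

  2*leaves*excess≤imbalance : 2 * (leaves * excess) ≤ imbalance G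
  2*leaves*excess≤imbalance = begin
    2 * (leaves * excess)
      ≡⟨ cong (λ s → leaves * excess + s) (+-identityʳ _) ⟩
    leaves * excess + leaves * excess
      -- Both copies of the product unfold into double sums; the second is transposed, so that the
      -- leaf may stand in either place of the pair.
      ≡⟨ cong₂ _+_ (∑∑-* ℓ e) (trans (∑-comm (λ x y → ℓ y * e x)) (∑∑-* ℓ e)) ⟨
    ∑[ x < N ] ∑[ y < N ] (ℓ x * e y) + ∑[ x < N ] ∑[ y < N ] (ℓ y * e x)
      ≡⟨ ∑-distrib-+ (λ x → ∑[ y < N ] (ℓ x * e y)) (λ x → ∑[ y < N ] (ℓ y * e x)) ⟨
    ∑[ x < N ] (∑[ y < N ] (ℓ x * e y) + ∑[ y < N ] (ℓ y * e x))
      ≡⟨ sum-cong-≗ (λ x → sym (∑-distrib-+ (λ y → ℓ x * e y) (λ y → ℓ y * e x))) ⟩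
    ∑[ x < N ] ∑[ y < N ] (ℓ x * e y + ℓ y * e x)
      ≤⟨ ∑-mono-≤ (λ x → ∑-mono-≤ λ y → isLeaf*excess≤∣-∣ (1≤d x) (1≤d y)) ⟩
    imbalance G ∎
    where
    open ≤-Reasoning
    ℓ e : Fin N → ℕ
    ℓ x = isLeaf (d x)
    e x = d x ∸ 1

  4k≤imbalance : 2 * (2 * k) ≤ imbalance G
  4k≤imbalance = ≤-trans (*-monoʳ-≤ 2 (*-mono-≤ 2≤leaves k≤excess)) 2*leaves*excess≤imbalance

  module _ (imbalance≤4k : imbalance G ≤ 2 * (2 * k)) where

    leaves*excess≤2k : leaves * excess ≤ 2 * k
    leaves*excess≤2k = *-cancelˡ-≤ 2 (≤-trans 2*leaves*excess≤imbalance imbalance≤4k)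

    excess≤k : excess ≤ k
    excess≤k = *-cancelˡ-≤ 2 (≤-trans (*-monoˡ-≤ excess 2≤leaves) leaves*excess≤2k)

    d≤2 : ∀ x → d x ≤ 2
    -- Bounding `leaves` requires cancelling `k`. For `k` equal to 0 the excess vanishes instead,
    -- and all degrees are at most 1.
    d≤2 x with m≤n⇒m<n∨m≡n (z≤n {k})
    ... | inj₂ 0≡k = m≤n⇒m≤1+n (m∸n≡0⇒m≤n (n≤0⇒n≡0
      (≤-trans (≤∑ (λ x → d x ∸ 1) x) (≤-trans excess≤k (≤-reflexive (sym 0≡k))))))
    ... | inj₁ k>0 = m∸n≡0⇒m≤n (n≤0⇒n≡0 (≤-trans (≤∑ (λ x → d x ∸ 2) x) ∑≤0))
      where
      leaves≤2 : leaves ≤ 2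
      leaves≤2 = *-cancelʳ-≤ leaves 2 k {{>-nonZero k>0}}
        (≤-trans (*-monoʳ-≤ leaves k≤excess) leaves*excess≤2k)
      -- At most 2 leaves and excess at most `k` add up to at most `N`, which leaves nothing for
      -- this sum.
      ∑≤0 : ∑[ x < N ] (d x ∸ 2) ≤ 0
      ∑≤0 = +-cancelˡ-≤ N _ 0 (begin
        N + ∑[ x < N ] (d x ∸ 2)  ≡⟨ leaves+excess ⟨
        leaves + excess           ≤⟨ +-mono-≤ leaves≤2 excess≤k ⟩
        N                         ≡⟨ +-identityʳ N ⟨
        N + 0                     ∎)
        where open ≤-Reasoning

    extremal⇒≅P : G ≅ P N
    extremal⇒≅P with a , _ , a-leaf ← anotherLeaf zero
      with π , maximal ← maximalPathTo G a =
      ≅P G connected acyclic d≤2 (≤-reflexive a-leaf) π maximal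

-- Paths

degree-P-zero : ∀ k → degree (P (2 + k)) zero ≡ 1
degree-P-zero k = trans (degree≡∑ (P (2 + k)) zero) (cong suc (∑-zero {k} λ _ → refl))

-- Deleting vertex 0 from a path leaves the shorter path: the adjacency tests of successors compute
-- to those of their predecessors.
degree-P-suc : ∀ n x →
  degree (P (suc n)) (suc x) ≡ 𝟙 (adj? (P (suc n)) (suc x) zero) + degree (P n) x
degree-P-suc n x = trans (degree≡∑ (P (suc n)) (suc x))
  (cong₂ _+_ {x = 𝟙 (adj? (P (suc n)) (suc x) zero)} refl (sym (degree≡∑ (P n) x)))

-- Vertex 0 is left out so that the induction goes through: lengthening the path at the front turns
-- the old first vertex from degree 1 to degree 2 and changes no other degree.
∑-degree-P-suc : ∀ k (h : ℕ → ℕ) →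
  ∑[ x < 1 + k ] h (degree (P (2 + k)) (suc x)) ≡ k * h 2 + h 1
∑-degree-P-suc zero    h = +-identityʳ _
∑-degree-P-suc (suc k) h = begin
  h (degree (P (3 + k)) (suc zero)) + ∑[ x < 1 + k ] h (degree (P (3 + k)) (suc (suc x)))
    ≡⟨ cong₂ _+_ (cong h (trans (degree-P-suc (2 + k) zero) (cong suc (degree-P-zero k))))
                 (sum-cong-≗ {1 + k} λ x → cong h (degree-P-suc (2 + k) (suc x))) ⟩
  h 2 + ∑[ x < 1 + k ] h (degree (P (2 + k)) (suc x))
    ≡⟨ cong₂ _+_ {x = h 2} refl (∑-degree-P-suc k h) ⟩
  h 2 + (k * h 2 + h 1)
    ≡⟨ +-assoc (h 2) (k * h 2) (h 1) ⟨
  suc k * h 2 + h 1 ∎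
  where open ≡-Reasoning

-- With `h` arbitrary, this evaluates both the inner and the outer sum of `imbalance`.
∑-degree-P : ∀ k (h : ℕ → ℕ) →
  ∑[ x < 2 + k ] h (degree (P (2 + k)) x) ≡ h 1 + (k * h 2 + h 1)
∑-degree-P k h = cong₂ _+_ (cong h (degree-P-zero k)) (∑-degree-P-suc k h)

imbalance-P : ∀ k → imbalance (P (2 + k)) ≡ 2 * (2 * k)
imbalance-P k = begin
  imbalance (P (2 + k))
    ≡⟨ sum-cong-≗ (λ x → ∑-degree-P k λ e → ∣ degree (P (2 + k)) x - e ∣) ⟩
  ∑[ x < 2 + k ] h (degree (P (2 + k)) x)
    ≡⟨ ∑-degree-P k h ⟩
  h 1 + (k * h 2 + h 1)
    ≡⟨ lemma k ⟩
  2 * (2 * k) ∎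
  where
  open ≡-Reasoning
  -- The inner sum for a vertex of degree `d`.
  h : ℕ → ℕ
  h d = ∣ d - 1 ∣ + (k * ∣ d - 2 ∣ + ∣ d - 1 ∣)
  -- The left side is `h 1 + (k * h 2 + h 1)` with the absolute differences evaluated.
  lemma : ∀ k → (k * 1 + 0) + (k * (1 + (k * 0 + 1)) + (k * 1 + 0)) ≡ 2 * (2 * k)
  lemma = solve-∀

-- Invariance under isomorphism

module _ {m n : ℕ} {G : Graph m} {H : Graph n} (G≅H : G ≅ H) where

  open _≅_ G≅H

  degree-≅ : ∀ x → degree G x ≡ degree H (to x)
  degree-≅ x = begin
    degree G x
      ≡⟨ degree≡∑ G x ⟩
    ∑[ y < m ] 𝟙 (adj? G x y)
      ≡⟨ sum-cong-≗ (λ y → 𝟙-⇔ (adj? G x y) (adj? H (to x) (to y)) (adj⇔ x y)) ⟩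
    ∑[ y < m ] 𝟙 (adj? H (to x) (to y))
      ≡⟨ sum-permute (λ z → 𝟙 (adj? H (to x) z)) bijection ⟨
    ∑[ z < n ] 𝟙 (adj? H (to x) z)
      ≡⟨ degree≡∑ H (to x) ⟨
    degree H (to x) ∎
    where open ≡-Reasoning

  imbalance-≅ : imbalance G ≡ imbalance H
  imbalance-≅ = begin
    imbalance G
      ≡⟨ sum-cong-≗ (λ x → sum-cong-≗ λ y → cong₂ ∣_-_∣ (degree-≅ x) (degree-≅ y)) ⟩
    ∑[ x < m ] ∑[ y < m ] ∣ degree H (to x) - degree H (to y) ∣
      ≡⟨ sum-cong-≗ (λ x → sum-permute (λ z → ∣ degree H (to x) - degree H z ∣) bijection) ⟨
    ∑[ x < m ] ∑[ z < n ] ∣ degree H (to x) - degree H z ∣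
      ≡⟨ sum-permute (λ w → ∑[ z < n ] ∣ degree H w - degree H z ∣) bijection ⟨
    imbalance H ∎
    where open ≡-Reasoning

-- Passage to the rationals

2*[2+k]-4 : ∀ k → + (2 * (2 + k)) - + 4 ≡ + (2 * k)
2*[2+k]-4 k = trans (cong (λ j → + j - + 4) (*-distribˡ-+ 2 2 k)) (ℤ.m-n≡m⊖n (4 + 2 * k) 4)

-- `_/_` reduces to lowest terms, so the comparison is made on unnormalised fractions, where it is
-- cross-multiplication.
half-≥ : ∀ s t → 2 * t ≤ s → (+ s) / 2 ≥ (+ t) / 1
half-≥ s t 2t≤s = ℚ.toℚᵘ-cancel-≤ (begin
  _               ≃⟨ ℚ.toℚᵘ-fromℚᵘ (ℚᵘ.mkℚᵘ (+ t) 0) ⟩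
  ℚᵘ.mkℚᵘ (+ t) 0 ≤⟨ ℚᵘ.*≤* (subst₂ ℤ._≤_ (ℤ.pos-* t 2) (ℤ.pos-* s 1)
                      (ℤ.+≤+ (subst₂ _≤_ (*-comm 2 t) (sym (*-identityʳ s)) 2t≤s))) ⟩
  ℚᵘ.mkℚᵘ (+ s) 1 ≃⟨ ℚ.toℚᵘ-fromℚᵘ (ℚᵘ.mkℚᵘ (+ s) 1) ⟨
  _               ∎)
  where open ℚᵘ.≤-Reasoning

half≡ : ∀ s t → (+ s) / 2 ≡ (+ t) / 1 → s ≡ 2 * t
half≡ s t eq with ℚ./-injective-≃ (ℚᵘ.mkℚᵘ (+ s) 1) (ℚᵘ.mkℚᵘ (+ t) 0) eq
... | ℚᵘ.*≡* s*1≡t*2 = trans (sym (*-identityʳ s)) (trans (ℤ.+-injective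
  (trans (ℤ.pos-* s 1) (trans s*1≡t*2 (sym (ℤ.pos-* t 2))))) (*-comm t 2))

half-double : ∀ t → (+ (2 * t)) / 2 ≡ (+ t) / 1
half-double t = ℚ.fromℚᵘ-cong {ℚᵘ.mkℚᵘ (+ (2 * t)) 1} {ℚᵘ.mkℚᵘ (+ t) 0} (ℚᵘ.*≡*
  (trans (ℤ.*-identityʳ _) (trans (cong (λ j → + j) (*-comm 2 t)) (ℤ.pos-* t 2))))

theorem5 : (n : ℕ) → 2 ≤ℕ n → (G : Graph n) → IsTree G →
    (irrₜ G ≥ (+ (2 * n) - + 4) / 1) ×
    ((irrₜ G ≡ (+ (2 * n) - + 4) / 1) ⇔ (G ≅ P n))
theorem5 (suc (suc k)) (s≤s (s≤s _)) G (connected , acyclic) =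
  -- The integer difference is replaced by `+ (2 * k)` in both halves of the claim at once.
  subst (λ z → (irrₜ G ≥ z / 1) × ((irrₜ G ≡ z / 1) ⇔ (G ≅ P (2 + k)))) (sym (2*[2+k]-4 k))
    ( half-≥ (imbalance G) (2 * k) (4k≤imbalance G connected acyclic)
    , mk⇔ (λ eq → extremal⇒≅P G connected acyclic (≤-reflexive (half≡ (imbalance G) (2 * k) eq)))
          (λ G≅P → trans (cong (λ s → (+ s) / 2) (trans (imbalance-≅ G≅P) (imbalance-P k)))
                         (half-double (2 * k))))
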